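{- Let $G$ be any (possibly infinite) graph. Then $G$ is cat-win if and only if at least one of the following holds: (1) $G$ has a minor isomorphic to the infinite complete binary tree $B^{\omega}$; (2) $G$ has a $2$-edge-connected subgraph with infinitely many vertices.
   Context: Cat Herding is played on a simple, possibly infinite graph $G$. The cat first places its token on a vertex. Then the players alternate, the herder moving first: the herder deletes one edge of the current graph, and then, unless the cat's current vertex has degree $0$ in the current graph, the cat moves its token along a finite path with at least one edge in the current graph to a different vertex. The cat is captured when its vertex has degree $0$ in the current graph. $G$ is cat-win if the cat has a strategy that is never captured. A graph is $2$-edge-connected if every pair of vertices is joined by at least $2$ edge-disjoint finite paths. $B^{\omega}$ is the graph with vertex set $\{L,R\}^*$ (finite words over $\{L,R\}$) and edges between $\alpha$ and $\alpha t$ for $\alpha\in\{L,R\}^*$, $t\in\{L,R\}$. -}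

module Defs where

open import Level using (Level; _⊔_; 0ℓ) renaming (suc to lsuc)
open import Data.List using (List; []; _∷_; _∷ʳ_)
open import Data.List.Membership.Propositional using (_∈_)
open import Data.List.Relation.Unary.Unique.Propositional using (Unique)
open import Data.Product using (Σ; ∃; ∃-syntax; _×_; _,_)
open import Data.Sum using (_⊎_; inj₁; inj₂; swap)
open import Function.Bundles using (_⇔_)
open import Relation.Binary.Core using (Rel)
open import Relation.Binary.Definitions using (Symmetric; Irreflexive)
open import Relation.Binary.Construct.Closure.ReflexiveTransitive using (Star; ε; _◅_)
open import Relation.Binary.PropositionalEquality using (_≡_; _≢_; refl)
open import Relation.Nullary using (¬_)
open import Relation.Unary using (Pred)

------------------------------------------------------------------------
-- Graphs and subgraphs

record SimpleGraph {ℓ : Level} (V : Set ℓ) : Set (lsuc ℓ) where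
  field
    Adj    : Rel V ℓ
    symm   : Symmetric Adj
    irrefl : Irreflexive _≡_ Adj

open SimpleGraph public using (Adj)

record Subgraph {ℓ : Level} {V : Set ℓ} (G : SimpleGraph V) : Set (lsuc ℓ) where
  field
    Verts    : Pred V ℓ
    SAdj     : Rel V ℓ
    SAdj⇒Adj : ∀ {u v} → SAdj u v → Adj G u v
    SAdj-src : ∀ {u v} → SAdj u v → Verts u
    SAdj-sym : Symmetric SAdj

open Subgraph public using (Verts; SAdj)

Finite : {a ℓ : Level} {A : Set a} → Pred A ℓ → Set (a ⊔ ℓ)
Finite {A = A} P = ∃[ xs ] (∀ (x : A) → P x → x ∈ xs)

Infinite : {a ℓ : Level} {A : Set a} → Pred A ℓ → Set (a ⊔ ℓ)
Infinite P = ¬ Finite P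

------------------------------------------------------------------------
-- Finite paths

-- Pairs represent undirected edges.
SameEdge : {ℓ : Level} {V : Set ℓ} → Rel (V × V) ℓ
SameEdge (a , b) (u , v) = (a ≡ u × b ≡ v) ⊎ (a ≡ v × b ≡ u)

module _ {a ℓ : Level} {V : Set a} {R : Rel V ℓ} where

  vertices : {u v : V} → Star R u v → List V
  vertices {u} ε        = u ∷ []
  vertices {u} (_ ◅ es) = u ∷ vertices es

  edges : {u v : V} → Star R u v → List (V × V)
  edges     ε                  = []
  edges {u} (_◅_ {j = w} _ es) = (u , w) ∷ edges es

Path : {a ℓ : Level} {V : Set a} → Rel V ℓ → Rel V (a ⊔ ℓ)
Path R u v = Σ (Star R u v) (λ p → Unique (vertices p))

EdgeDisjoint : {a ℓ : Level} {V : Set a} {R : Rel V ℓ} {u v : V} →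
               Path R u v → Path R u v → Set a
EdgeDisjoint (p , _) (q , _) =
  ∀ e f → e ∈ edges p → f ∈ edges q → ¬ SameEdge e f

TwoEdgeConnected : {ℓ : Level} {V : Set ℓ} {G : SimpleGraph V} → Subgraph G → Set ℓ
TwoEdgeConnected S =
  ∀ u v → Verts S u → Verts S v → u ≢ v →
  Σ (Path (SAdj S) u v) λ p → Σ (Path (SAdj S) u v) λ q → EdgeDisjoint p q

HasInfinite2ECSubgraph : {ℓ : Level} {V : Set ℓ} → SimpleGraph V → Set (lsuc ℓ)
HasInfinite2ECSubgraph G =
  Σ (Subgraph G) λ S → TwoEdgeConnected S × Infinite (Verts S)

------------------------------------------------------------------------
-- Minors

-- H is (up to isomorphism) obtained from the subgraph S of G by contracting
-- each class of a partition of the vertices of S into nonempty connected sets,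
-- which may be infinite, and discarding the resulting loops and parallel edges.
-- The class contracted to the vertex x of H is Branch x.
record Minor {h ℓ : Level} {W : Set h} {V : Set ℓ}
             (H : SimpleGraph W) (G : SimpleGraph V) : Set (h ⊔ lsuc ℓ) where
  field
    S         : Subgraph G
    Branch    : W → Pred V ℓ
    covers    : ∀ v → Verts S v ⇔ (∃[ x ] Branch x v)
    disjoint  : ∀ {x y v} → Branch x v → Branch y v → x ≡ y
    nonempty  : ∀ x → ∃[ v ] Branch x v
    connected : ∀ x u v → Branch x u → Branch x v →
                Path (λ a b → Branch x a × Branch x b × SAdj S a b) u v
    adjacent  : ∀ x y → x ≢ y →
                Adj H x y ⇔ (∃[ u ] ∃[ v ] (Branch x u × Branch y v × SAdj S u v))

------------------------------------------------------------------------
-- The infinite complete binary tree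

data Letter : Set where
  L R : Letter

Bω : SimpleGraph (List Letter)
Bω = record
  { Adj    = λ α β → Extends α β ⊎ Extends β α
  ; symm   = swap
  ; irrefl = λ { refl (inj₁ (t , eq)) → ≢-∷ʳ _ t eq
               ; refl (inj₂ (t , eq)) → ≢-∷ʳ _ t eq }
  }
  where
  Extends : Rel (List Letter) 0ℓ
  Extends α β = ∃[ t ] β ≡ α ∷ʳ t

  ≢-∷ʳ : (α : List Letter) (t : Letter) → α ≢ α ∷ʳ t
  ≢-∷ʳ (_ ∷ α) t eq = ≢-∷ʳ α t (tail-≡ eq)
    where
    tail-≡ : {x y : Letter} {xs ys : List Letter} → x ∷ xs ≡ y ∷ ys → xs ≡ ys
    tail-≡ refl = refl

------------------------------------------------------------------------
-- Cat Herding

module _ {ℓ : Level} {V : Set ℓ} where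

  deleteEdge : SimpleGraph V → V × V → SimpleGraph V
  deleteEdge G e = record
    { Adj    = λ a b → Adj G a b × ¬ SameEdge (a , b) e
    ; symm   = λ { (ab , ≠e) → SimpleGraph.symm G ab , λ s → ≠e (flip-edge s) }
    ; irrefl = λ { eq (ab , _) → SimpleGraph.irrefl G eq ab }
    }
    where
    flip-edge : ∀ {a b} → SameEdge (b , a) e → SameEdge (a , b) e
    flip-edge (inj₁ (p , q)) = inj₂ (q , p)
    flip-edge (inj₂ (p , q)) = inj₁ (q , p)

  -- The herder's moves so far, most recent first.
  History : Set ℓ
  History = List (V × V)

  remaining : SimpleGraph V → History → SimpleGraph V
  remaining G []       = G
  remaining G (e ∷ es) = deleteEdge (remaining G es) e

  data Legal (G : SimpleGraph V) : History → Set ℓ where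
    []  : Legal G []
    _∷_ : ∀ {u v es} → Adj (remaining G es) u v → Legal G es → Legal G ((u , v) ∷ es)

  -- σ [] is the starting vertex, and σ (e ∷ es) is the cat's position after its
  -- reply to the deletion of e. The cat's own earlier positions are determined
  -- by σ and the tails of the history, so they need not be recorded.
  Strategy : Set ℓ
  Strategy = History → V

  Captured : SimpleGraph V → V → Set ℓ
  Captured G v = ∀ w → ¬ Adj G v w

  -- A path with at least one edge is exactly one between different vertices.
  CatMove : SimpleGraph V → V → V → Set ℓ
  CatMove G x y = x ≢ y × Path (Adj G) x y

  -- The initial condition is not implied by the second one: in a graph without
  -- edges the herder has no move, but the cat is captured at once.
  NeverCaptured : SimpleGraph V → Strategy → Set ℓ
  NeverCaptured G σ =
    ¬ Captured G (σ []) ×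
    (∀ e es → Legal G (e ∷ es) →
       ¬ Captured (remaining G (e ∷ es)) (σ es) ×
       CatMove (remaining G (e ∷ es)) (σ es) (σ (e ∷ es)))

  CatWin : SimpleGraph V → Set ℓ
  CatWin G = ∃[ σ ] NeverCaptured G σ

{-# OPTIONS --safe #-}
module Submission where

-- If X is an infinite 2-edge-connected subgraph, then X minus an edge ab has finitely
-- many 2-edge-connected classes, one for each vertex of an a–b path at most; one of them
-- is infinite, and the cat moves there. In a Bω minor the cat waits where the branch set
-- of x is joined to that of xL, and moves on to xL unless the herder has just cut below
-- xL, in which case it goes to xR.
--
-- Conversely, let the cat win on G without an infinite 2-edge-connected subgraph. If no
-- bridge had winning positions on both of its sides afterwards, then all winning positions
-- would lie in one finite 2-edge-connected class, and the herder would win by deleting the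
-- edges of this class. So every winning region is split by a bridge into two winning
-- regions. Repeated splitting yields a connected root region adjacent to two disjoint
-- winning regions, and iterating this in both gives the branch sets of a Bω minor.

open import Defs hiding (L; R)
open import Level using (Level) renaming (suc to lsuc)
open import Axiom.ExcludedMiddle using (ExcludedMiddle)
open import Data.Empty using (⊥)
open import Data.List using (List; []; _∷_; _∷ʳ_; _++_; concatMap; cartesianProduct)
open import Data.List.Membership.Propositional using (_∈_; lose)
open import Data.List.Membership.Propositional.Properties
  using (∈-concatMap⁺; ∈-cartesianProduct⁺)
open import Data.List.Properties using (∷ʳ-++; ++-identityʳ; ++-cancelˡ)
open import Data.List.Relation.Unary.All using (All; []; _∷_)
open import Data.List.Relation.Unary.All.Properties using (¬Any⇒All¬)
open import Data.List.Relation.Unary.AllPairs using ([]; _∷_)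
open import Data.List.Relation.Unary.Any using (here; there)
open import Data.List.Relation.Unary.Unique.Propositional using (Unique)
open import Data.Nat using (ℕ; zero; suc; _<_; z≤n; s≤s; s≤s⁻¹)
open import Data.Nat.Properties using (≤-trans; ≤-refl)
open import Data.Product using (Σ-syntax; ∃-syntax; _×_; _,_; proj₁; proj₂)
open import Data.Sum using (_⊎_; inj₁; inj₂; [_,_]′) renaming (map to map⊎)
open import Function.Base using (_∘_; id)
open import Function.Bundles using (_⇔_; mk⇔; Equivalence)
open import Relation.Binary.Construct.Closure.ReflexiveTransitive
  using (Star; ε; _◅_; _◅◅_; map; reverse)
open import Relation.Binary.Core using (Rel; _⇒_)
open import Relation.Binary.Definitions using (Symmetric)
open import Relation.Binary.PropositionalEquality
  using (_≡_; _≢_; refl; sym; cong; subst)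
open import Relation.Nullary using (¬_; yes; no; contradiction)
open import Relation.Unary using (Pred)

-- Walks and edge deletion

module _ {a} {V : Set a} where

  SameEdge-flip : ∀ {x y : V} {e} → SameEdge (x , y) e → SameEdge (y , x) e
  SameEdge-flip (inj₁ (p , q)) = inj₂ (q , p)
  SameEdge-flip (inj₂ (p , q)) = inj₁ (q , p)

  SameEdge-sym : {e f : V × V} → SameEdge e f → SameEdge f e
  SameEdge-sym (inj₁ (refl , refl)) = inj₁ (refl , refl)
  SameEdge-sym (inj₂ (refl , refl)) = inj₂ (refl , refl)

  SameEdge-trans : {e f g : V × V} → SameEdge e f → SameEdge f g → SameEdge e g
  SameEdge-trans (inj₁ (refl , refl)) s = s
  SameEdge-trans (inj₂ (refl , refl)) s = SameEdge-flip s

  module _ {ℓ} {R : Rel V ℓ} where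

    steps : ∀ {u v} → Star R u v → ℕ
    steps ε       = zero
    steps (_ ◅ p) = suc (steps p)

    first∈vertices : ∀ {u v} (p : Star R u v) → u ∈ vertices p
    first∈vertices ε       = here refl
    first∈vertices (_ ◅ p) = here refl

    last∈vertices : ∀ {u v} (p : Star R u v) → v ∈ vertices p
    last∈vertices ε       = here refl
    last∈vertices (_ ◅ p) = there (last∈vertices p)

    vertices-map : ∀ {ℓ′} {Q : Rel V ℓ′} (f : R ⇒ Q) {u v} (p : Star R u v) →
                   vertices (map {U = Q} f p) ≡ vertices p
    vertices-map f ε       = refl
    vertices-map f (_ ◅ p) = cong (_ ∷_) (vertices-map f p)

    edges-map : ∀ {ℓ′} {Q : Rel V ℓ′} (f : R ⇒ Q) {u v} (p : Star R u v) {x y} →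
                (x , y) ∈ edges (map {U = Q} f p) → R x y
    edges-map f (r ◅ p) (here refl) = r
    edges-map f (r ◅ p) (there m)   = edges-map f p m

    mapPath : ∀ {ℓ′} {Q : Rel V ℓ′} (f : R ⇒ Q) {u v} → Path R u v → Path Q u v
    mapPath f (p , up) = map f p , subst Unique (sym (vertices-map f p)) up

    prefix : ∀ {u v} (p : Star R u v) {z} → z ∈ vertices p →
             Star (λ x y → R x y × x ∈ vertices p × y ∈ vertices p) u z
    prefix ε       (here refl) = ε
    prefix (r ◅ p) (here refl) = ε
    prefix (r ◅ p) (there m)   =
      (r , here refl , there (first∈vertices p)) ◅
      map (λ (s , i , j) → s , there i , there j) (prefix p m)

    uniqueSuffix : ∀ {u v} (p : Star R u v) → Unique (vertices p) →
                   ∀ {z} → z ∈ vertices p → Path R z v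
    uniqueSuffix ε       up       (here refl) = ε , up
    uniqueSuffix (r ◅ p) up       (here refl) = r ◅ p , up
    uniqueSuffix (r ◅ p) (_ ∷ up) (there m)   = uniqueSuffix p up m

    -- Recording that every vertex on the way is reachable from `t` lets a walk be confined to a
    -- reachable set.
    tracked : ∀ {t u v} → Star R t u → Star R u v →
              Star (λ x y → R x y × Star R t x × Star R t y) u v
    tracked h ε       = ε
    tracked h (r ◅ p) = (r , h , h ◅◅ (r ◅ ε)) ◅ tracked (h ◅◅ (r ◅ ε)) p

module _ {ℓ} {V : Set ℓ} where

  infixl 6 _∖_

  _∖_ : Rel V ℓ → V × V → Rel V ℓ
  (R ∖ e) x y = R x y × ¬ SameEdge (x , y) e

  _↾_ : Rel V ℓ → Pred V ℓ → Rel V ℓ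
  (R ↾ X) x y = R x y × X x × X y

  ∖-sym : {R : Rel V ℓ} → Symmetric R → ∀ e → Symmetric (R ∖ e)
  ∖-sym symR e (r , ≠e) = symR r , ≠e ∘ SameEdge-flip

  rev : {R : Rel V ℓ} → Symmetric R → ∀ {u v} → Star R u v → Star R v u
  rev symR = reverse symR

  avoid : {R : Rel V ℓ} {e : V × V} {u v : V} (p : Star R u v) →
          (∀ f → f ∈ edges p → ¬ SameEdge f e) → Star (R ∖ e) u v
  avoid ε       _ = ε
  avoid (r ◅ p) h = (r , h _ (here refl)) ◅ avoid p (λ f m → h f (there m))

  avoid-vertex : {Q : Rel V ℓ} {e : V × V} {u u′ y w : V} (p : Star Q y w) →
                 All (u ≢_) (vertices p) → SameEdge (u , u′) e → Star (Q ∖ e) y w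
  avoid-vertex ε       _         s = ε
  avoid-vertex (q ◅ p) (u≢y ∷ h) s =
    (q , λ t → apart p u≢y h (SameEdge-trans s (SameEdge-sym t))) ◅ avoid-vertex p h s
    where
    apart : ∀ {Q : Rel V ℓ} {u u′ y z w : V} (p : Star Q z w) → u ≢ y →
            All (u ≢_) (vertices p) → ¬ SameEdge (u , u′) (y , z)
    apart p       n _       (inj₁ (refl , _)) = n refl
    -- Splitting the walk exposes `z` as its first vertex.
    apart ε       _ (n ∷ _) (inj₂ (refl , _)) = n refl
    apart (_ ◅ _) _ (n ∷ _) (inj₂ (refl , _)) = n refl

  -- The 2-edge-connected class of `v`, in the form given by Menger's theorem. Forgetting the
  -- deletion of any `e`, say the loop `(v , v)`, gives plain reachability.
  Class : Rel V ℓ → V → Pred V ℓ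
  Class R v w = ∀ e → Star (R ∖ e) v w

  -- 2-edge-connectedness as survival of any one deletion, the form that suits the game; Menger's
  -- theorem turns it into disjoint paths.
  record Robust (Q : Rel V ℓ) (X : Pred V ℓ) : Set ℓ where
    field
      symQ   : Symmetric Q
      source : ∀ {x y} → Q x y → X x
      linked : ∀ e {u w} → X u → X w → Star (Q ∖ e) u w

    closed : ∀ {x y} → Star Q x y → X x → X y
    closed ε       xx = xx
    closed (q ◅ p) xx = closed p (source (symQ q))

  -- The walks may repeat vertices: disjointness of the symmetric edge sets `A` and `B` passes to
  -- all paths extracted within them.
  record TwoDisjoint (R : Rel V ℓ) (u v : V) : Set (lsuc ℓ) where
    field
      A B      : Rel V ℓ
      A⊆       : A ⇒ R
      B⊆       : B ⇒ R
      symA     : Symmetric A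
      symB     : Symmetric B
      disjoint : ∀ {x y} → A x y → ¬ B x y
      walkA    : Star A u v
      walkB    : Star B u v

  -- Cat strategies from an invariant

  catWin-invariant : ∀ {i} (I : Rel V ℓ → V → Set i) →
    (∀ (G : SimpleGraph V) {c} → I (Adj G) c → ∀ e →
       ∃[ w ] c ≢ w × Path (Adj G ∖ e) c w × I (Adj G ∖ e) w) →
    (G : SimpleGraph V) {c : V} → I (Adj G) c → CatWin G
  catWin-invariant I step G {c₀} I₀ = proj₁ ∘ play , start , reply
    where
    -- The step applies to every pair, so positions are computed by recursion on arbitrary
    -- histories.
    play : ∀ es → ∃[ c ] I (Adj (remaining G es)) c
    play []       = c₀ , I₀
    play (e ∷ es) =
      let H = remaining G es
          w , _ , _ , Iw = step H (proj₂ (play es)) e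
      in w , Iw

    notStuck : ∀ {R : Rel V ℓ} {c w} → c ≢ w → Star R c w → ¬ (∀ x → ¬ R c x)
    notStuck c≢w ε       _ = c≢w refl
    notStuck _   (r ◅ _) s = s _ r

    start : ¬ Captured G c₀
    -- Any pair would do here: a walk to another vertex provides an edge at `c₀`.
    start s with step G I₀ (c₀ , c₀)
    ... | _ , c≢w , (p , _) , _ = notStuck c≢w p (λ x (r , _) → s x r)

    reply : ∀ e es → Legal G (e ∷ es) →
            ¬ Captured (remaining G (e ∷ es)) (proj₁ (play es)) ×
            CatMove (remaining G (e ∷ es)) (proj₁ (play es)) (proj₁ (play (e ∷ es)))
    reply e es _ =
      let H = remaining G es
          _ , c≢w , p , _ = step H (proj₂ (play es)) e
      in notStuck c≢w (proj₁ p) , c≢w , p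

module Classical (em : ∀ {a} → ExcludedMiddle a) {ℓ} {V : Set ℓ} where

  dne : ∀ {a} {P : Set a} → ¬ ¬ P → P
  dne {P = P} nn with em {P = P}
  ... | yes p = p
  ... | no  n = contradiction n nn

  -- Simple paths and first crossings of an edge

  toPath : {R : Rel V ℓ} {u v : V} → Star R u v → Path R u v
  toPath ε = ε , [] ∷ []
  toPath {u = u} (r ◅ p) with toPath p
  ... | q , uq with em {P = u ∈ vertices q}
  -- Loop erasure: if the walk returns to `u`, it is restarted from that return.
  ...   | yes m = uniqueSuffix q uq m
  ...   | no  n = r ◅ q , ¬Any⇒All¬ _ n ∷ uq

  firstHit : {R : Rel V ℓ} (D : Pred V ℓ) {w u : V} → Star R w u → D u →
             ∃[ z ] D z × Star (λ x y → R x y × ¬ D x) w z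
  firstHit D {w} p d with em {P = D w}
  ... | yes dw = w , dw , ε
  firstHit D ε       d | no n = contradiction d n
  firstHit D (r ◅ p) d | no n with firstHit D p d
  ... | z , dz , q = z , dz , (r , n) ◅ q

  -- The walk is followed up to its first crossing of `e`. The strict length bound makes the
  -- recursion in `fork` terminate.
  truncate : {R : Rel V ℓ} (e : V × V) {u v : V} (p : Star R u v) →
             Star (R ∖ e) u v ⊎
             (∃[ x ] ∃[ y ] SameEdge (x , y) e × R x y ×
                Σ[ q ∈ Star (R ∖ e) u x ] steps q < steps p)
  truncate e ε = inj₁ ε
  truncate e {u} (_◅_ {j = y} r p) with em {P = SameEdge (u , y) e}
  ... | yes s = inj₂ (u , y , s , r , ε , s≤s z≤n)
  ... | no  n with truncate e p
  ...   | inj₁ q = inj₁ ((r , n) ◅ q)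
  ...   | inj₂ (x , y , s , r′ , q , lt) = inj₂ (x , y , s , r′ , (r , n) ◅ q , s≤s lt)

  toEndpoint : {R : Rel V ℓ} {a b u : V} → Star R u a →
               Star (R ∖ (a , b)) u a ⊎ Star (R ∖ (a , b)) u b
  toEndpoint {a = a} {b} p with truncate (a , b) p
  ... | inj₁ q = inj₁ q
  ... | inj₂ (_ , _ , inj₁ (refl , refl) , _ , q , _) = inj₁ q
  ... | inj₂ (_ , _ , inj₂ (refl , refl) , _ , q , _) = inj₂ q

  -- Cut at their first crossings of `e`, the walk from `v` and its reverse from `w` stop at
  -- opposite ends; a common end would join `v` and `w` without `e`.
  bridge-on : {R : Rel V ℓ} → Symmetric R → ∀ e {v w} →
              Star R v w → ¬ Star (R ∖ e) v w →
              ∃[ x ] ∃[ y ] SameEdge (x , y) e × R x y ×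
                Star (R ∖ e) v x × Star (R ∖ e) w y
  bridge-on symR e p n with truncate e p | truncate e (rev symR p)
  ... | inj₁ q | _ = contradiction q n
  ... | _ | inj₁ q = contradiction (rev (∖-sym symR e) q) n
  ... | inj₂ (x , y , s , r , q , _) | inj₂ (x′ , _ , s′ , _ , q′ , _) =
    x , y , s , r , q , subst (Star _ _) (other (SameEdge-trans s′ (SameEdge-sym s))) q′
    where
    other : ∀ {y′} → SameEdge (x′ , y′) (x , y) → x′ ≡ y
    other (inj₂ (x′≡y , _)) = x′≡y
    other (inj₁ (refl , _)) = contradiction (q ◅◅ rev (∖-sym symR e) q′) n

  -- Menger's theorem for two paths

  -- B is prolonged by e = vw, and A by the reverse of a walk that starts in w and first
  -- meets D in z. Confining A and B to D makes this ear disjoint from both.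
  ear : ∀ {R : Rel V ℓ} (A B : Rel V ℓ) {u v w z} → Symmetric R → R v w →
    let e = (v , w) ; D = λ x → Star A u x ⊎ Star B u x in
    A ⇒ (R ∖ e) → B ⇒ (R ∖ e) → Symmetric A → Symmetric B →
    (∀ {x y} → A x y → ¬ B x y) → Star A u z → Star B u v →
    Star (λ x y → (R ∖ e) x y × ¬ D x) w z → TwoDisjoint R u w
  ear {R} A B {u} {v} {w} symR vw A⊆ B⊆ symA symB dis az bv t = record
    { A = A′ ; B = B′
    ; A⊆ = λ { (inj₁ (a , _)) → proj₁ (A⊆ a) ; (inj₂ (r , _)) → proj₁ r }
    ; B⊆ = λ { (inj₁ (b , _)) → proj₁ (B⊆ b)
             ; (inj₂ (inj₁ (refl , refl))) → vw
             ; (inj₂ (inj₂ (refl , refl))) → symR vw }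
    ; symA = symA′
    ; symB = λ { (inj₁ (b , dx , dy)) → inj₁ (symB b , dy , dx)
               ; (inj₂ s) → inj₂ (SameEdge-flip s) }
    ; disjoint = λ { (inj₁ (a , _)) (inj₁ (b , _)) → dis a b
                   ; (inj₁ (a , _)) (inj₂ s) → proj₂ (A⊆ a) s
                   ; (inj₂ (_ , n)) (inj₁ (_ , d)) → n d
                   ; (inj₂ (r , _)) (inj₂ s) → proj₂ r s }
    ; walkA = map (λ (a , h , k) → inj₁ (a , inj₁ h , inj₁ k)) (tracked ε az) ◅◅
              reverse {U = A′} symA′ (map (λ (r , n) → inj₂ (r , n ∘ proj₁)) t)
    ; walkB = map (λ (b , h , k) → inj₁ (b , inj₂ h , inj₂ k)) (tracked ε bv) ◅◅
              (inj₂ (inj₁ (refl , refl)) ◅ ε)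
    }
    where
    D : Pred V ℓ
    D x = Star A u x ⊎ Star B u x
    A′ B′ : Rel V ℓ
    -- `A′` gains all edges other than `vw` that do not lie within `D`; the ear is among them, as
    -- each of its steps starts outside `D`.
    A′ x y = (A ↾ D) x y ⊎ ((R ∖ (v , w)) x y × ¬ (D x × D y))
    B′ x y = (B ↾ D) x y ⊎ SameEdge (x , y) (v , w)
    symA′ : Symmetric A′
    symA′ (inj₁ (a , dx , dy)) = inj₁ (symA a , dy , dx)
    symA′ (inj₂ (r , n)) = inj₂ (∖-sym symR (v , w) r , λ (dx , dy) → n (dy , dx))

  -- Induction step of Menger's theorem. Stripped of `vw`, each walk reaches `v` or `w`. If one
  -- stops at `v`, it goes on across `vw`, while the other uses an ear, which is empty if that walk
  -- has reached `w`.
  twoExtend : ∀ {R : Rel V ℓ} {u v w} → Symmetric R → R v w →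
              Star (R ∖ (v , w)) w u → TwoDisjoint R u v → TwoDisjoint R u w
  twoExtend {R} {u} {v} {w} symR vw back d =
    cases (toEndpoint walkA) (toEndpoint walkB)
    where
    open TwoDisjoint d
    e = (v , w)

    sA : Symmetric (A ∖ e)
    sA = ∖-sym symA e
    sB : Symmetric (B ∖ e)
    sB = ∖-sym symB e
    A⊆e : (A ∖ e) ⇒ (R ∖ e)
    A⊆e (a , n) = A⊆ a , n
    B⊆e : (B ∖ e) ⇒ (R ∖ e)
    B⊆e (b , n) = B⊆ b , n
    dis : ∀ {x y} → (A ∖ e) x y → ¬ (B ∖ e) x y
    dis (a , _) (b , _) = disjoint a b

    cases : Star (A ∖ e) u v ⊎ Star (A ∖ e) u w → Star (B ∖ e) u v ⊎ Star (B ∖ e) u w →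
            TwoDisjoint R u w
    cases (inj₂ aw) (inj₂ bw) = record
      { A = A ∖ e ; B = B ∖ e ; A⊆ = A⊆ ∘ proj₁ ; B⊆ = B⊆ ∘ proj₁ ; symA = sA ; symB = sB
      ; disjoint = dis ; walkA = aw ; walkB = bw }
    cases (inj₂ aw) (inj₁ bv) =
      ear (A ∖ e) (B ∖ e) symR vw A⊆e B⊆e sA sB dis aw bv ε
    cases (inj₁ av) (inj₂ bw) =
      ear (B ∖ e) (A ∖ e) symR vw B⊆e A⊆e sB sA (λ b a → dis a b) bw av ε
    cases (inj₁ av) (inj₁ bv)
      -- `back` ends in `u`, which is trivially reachable, so a first meeting point exists.
      with firstHit (λ x → Star (A ∖ e) u x ⊎ Star (B ∖ e) u x) back (inj₁ ε)
    ... | z , inj₁ az , t =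
      ear (A ∖ e) (B ∖ e) symR vw A⊆e B⊆e sA sB dis az bv t
    ... | z , inj₂ bz , t =
      ear (B ∖ e) (A ∖ e) symR vw B⊆e A⊆e sB sA (λ b a → dis a b) bz av
        (map (λ (r , n) → r , n ∘ [ inj₂ , inj₁ ]′) t)

  -- Induction along a walk from `v` to `u`, read from its end; robustness supplies the return walk
  -- that avoids the edge just added.
  robust⇒twoDisjoint : ∀ {Q X} → Robust Q X → ∀ {u v} → X u → X v → TwoDisjoint Q u v
  robust⇒twoDisjoint {Q} {X} rob {u} {v} xu xv =
    go xv (map proj₁ (linked (v , u) xv xu))
    where
    open Robust rob
    go : ∀ {v} → X v → Star Q v u → TwoDisjoint Q u v
    go xv ε = record
      { A = λ _ _ → None ; B = λ _ _ → None ; A⊆ = λ () ; B⊆ = λ ()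
      ; symA = λ () ; symB = λ () ; disjoint = λ () ; walkA = ε ; walkB = ε }
      where
      None : Set ℓ
      None = Level.Lift ℓ ⊥
    go xv (r ◅ p) =
      let xy = source (symQ r) in
      twoExtend symQ (symQ r) (linked _ xv xu) (go xy p)

  robust⇒infinite2EC : ∀ {G : SimpleGraph V} {Q X} → Robust Q X → Q ⇒ Adj G →
                       Infinite X → HasInfinite2ECSubgraph G
  robust⇒infinite2EC {G} {Q} {X} rob Q⊆G inf = S , twoPaths , inf
    where
    open Robust rob
    S : Subgraph G
    S = record { Verts = X ; SAdj = Q ; SAdj⇒Adj = Q⊆G ; SAdj-src = source
               ; SAdj-sym = symQ }
    twoPaths : TwoEdgeConnected S
    twoPaths u v xu xv _ = mapPath A⊆ p , mapPath B⊆ q , disj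
      where
      open TwoDisjoint (robust⇒twoDisjoint rob xu xv)
      p = toPath walkA
      q = toPath walkB
      disj : EdgeDisjoint (mapPath A⊆ p) (mapPath B⊆ q)
      disj e f m n (inj₁ (refl , refl)) =
        disjoint (edges-map A⊆ (proj₁ p) m) (edges-map B⊆ (proj₁ q) n)
      disj e f m n (inj₂ (refl , refl)) =
        disjoint (edges-map A⊆ (proj₁ p) m) (symB (edges-map B⊆ (proj₁ q) n))

  -- 2-edge-connected subgraphs and classes

  twoEdgeConnected⇒robust : ∀ {G : SimpleGraph V} (S : Subgraph G) →
                            TwoEdgeConnected S → Robust (SAdj S) (Verts S)
  twoEdgeConnected⇒robust S tec = record
    { symQ = Subgraph.SAdj-sym S ; source = Subgraph.SAdj-src S ; linked = linked }
    where
    linked : ∀ e {u w} → Verts S u → Verts S w → Star (SAdj S ∖ e) u w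
    linked e {u} {w} su sw with em {P = u ≡ w}
    ... | yes refl = ε
    ... | no u≢w with tec u w su sw u≢w
    -- At most one of two edge-disjoint paths contains `e`.
    ...   | (p , _) , (q , _) , disj with em {P = ∃[ f ] f ∈ edges p × SameEdge f e}
    ...     | no n = avoid p (λ f m s → n (f , m , s))
    ...     | yes (f , m , s) =
      avoid q (λ g m′ s′ → disj f g m m′ (SameEdge-trans s (SameEdge-sym s′)))

  -- Only the first edge u─y of the walk could separate y from v, and the rest of a
  -- simple walk avoids that edge.
  classWalk : {Q R : Rel V ℓ} → Symmetric R → Q ⇒ R → ∀ {v u w} (p : Star Q u w) →
              Unique (vertices p) → Class R v u → Class R v w →
              Star (Q ↾ Class R v) u w
  classWalk symR Q⊆R ε _ _ _ = ε
  classWalk {Q} {R} symR Q⊆R {v} {u} (_◅_ {j = y} q p) (u∉p ∷ up) cu cw =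
    (q , cu , cy) ◅ classWalk symR Q⊆R p up cy cw
    where
    cy : Class R v y
    cy e with em {P = SameEdge (u , y) e}
    ... | no  n = cu e ◅◅ ((Q⊆R q , n) ◅ ε)
    ... | yes s =
      cw e ◅◅ rev (∖-sym symR e) (map (λ (r , n) → Q⊆R r , n) (avoid-vertex p u∉p s))

  -- Two members are joined through `v` without `e`; made simple, this walk stays inside the class
  -- by `classWalk`.
  class-robust : {R : Rel V ℓ} → Symmetric R → ∀ v → Robust (R ↾ Class R v) (Class R v)
  class-robust symR v = record
    { symQ   = λ (r , x , y) → symR r , y , x
    ; source = λ (_ , x , _) → x
    ; linked = λ e cu cw →
        let p , up = toPath (rev (∖-sym symR e) (cu e) ◅◅ cw e) in
        map (λ ((r , n) , x , y) → (r , x , y) , n) (classWalk symR proj₁ p up cu cw)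
    }

  -- A cat on a 2-edge-connected subgraph

  infinite⇒another : {X : Pred V ℓ} → Infinite X → ∀ c → ∃[ w ] X w × c ≢ w
  infinite⇒another {X} inf c with em {P = ∃[ w ] X w × c ≢ w}
  ... | yes h = h
  ... | no  n = contradiction (c ∷ [] , only) inf
    where
    only : ∀ x → X x → x ∈ c ∷ []
    only x xx = here (sym (dne λ c≢x → n (x , xx , c≢x)))

  -- Every w ∈ X lies in the class of the vertex where a walk from w first meets a
  -- fixed walk P from a to b.  As P is finite, one of these classes is infinite.
  infiniteClass : ∀ {Q X} → Robust Q X → Infinite X → ∀ {a b} → X a → X b →
                  ∃[ z ] X z × Infinite (Class (Q ∖ (a , b)) z)
  infiniteClass {Q} {X} rob inf {a} {b} xa xb
    with em {P = ∃[ z ] X z × Infinite (Class (Q ∖ (a , b)) z)}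
  ... | yes h = h
  ... | no none = contradiction (concatMap (proj₁ ∘ fin) vP , all∈) inf
    where
    open Robust rob
    S : Rel V ℓ
    S = Q ∖ (a , b)
    symS : Symmetric S
    symS = ∖-sym symQ (a , b)
    P : Star S a b
    P = linked (a , b) xa xb
    vP : List V
    vP = vertices P

    fin : ∀ z → ∃[ xs ] (∀ w → X z → Class S z w → w ∈ xs)
    fin z with em {P = Finite (Class S z)}
    ... | yes (xs , h) = xs , λ w _ → h w
    -- Here `z` must lie outside `X`, so the empty list serves vacuously.
    ... | no  i        = [] , λ w xz _ → contradiction (z , xz , i) none

    -- If both ends of `cd` lie on `P`, then `t` avoids `cd`. Otherwise `P` avoids it, and a walk
    -- from `w` without `cd`, stopped at its first crossing of `ab`, reaches an end of `P` and
    -- continues along `P` to `z`.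
    class : ∀ {w z} → X w → z ∈ vP → Star (λ x y → S x y × ¬ x ∈ vP) w z → Class S z w
    class {w} {z} xw z∈P t (c , d) with em {P = c ∈ vP × d ∈ vP}
    ... | yes (c∈ , d∈) = rev (∖-sym symS (c , d)) (map off t)
      where
      off : (λ x y → S x y × ¬ x ∈ vP) ⇒ (S ∖ (c , d))
      off (s , x∉) = s , λ { (inj₁ (refl , _)) → x∉ c∈ ; (inj₂ (refl , _)) → x∉ d∈ }
    ... | no n = along (toEndpoint (linked (c , d) xw xa))
      where
      off : (λ x y → S x y × x ∈ vP × y ∈ vP) ⇒ (S ∖ (c , d))
      off (s , x∈ , y∈) =
        s , λ { (inj₁ (refl , refl)) → n (x∈ , y∈) ; (inj₂ (refl , refl)) → n (y∈ , x∈) }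
      swap∖ : (Q ∖ (c , d) ∖ (a , b)) ⇒ (S ∖ (c , d))
      swap∖ ((q , ≠f) , ≠e) = (q , ≠e) , ≠f
      back : Star (S ∖ (c , d)) z a
      back = rev (∖-sym symS (c , d)) (map off (prefix P z∈P))
      whole : Star (S ∖ (c , d)) a b
      whole = map off (prefix P (last∈vertices P))
      along : Star (Q ∖ (c , d) ∖ (a , b)) w a ⊎ Star (Q ∖ (c , d) ∖ (a , b)) w b →
              Star (S ∖ (c , d)) z w
      along (inj₁ p) = back ◅◅ rev (∖-sym symS (c , d)) (map swap∖ p)
      along (inj₂ p) = back ◅◅ whole ◅◅ rev (∖-sym symS (c , d)) (map swap∖ p)

    all∈ : ∀ w → X w → w ∈ concatMap (proj₁ ∘ fin) vP
    all∈ w xw with firstHit (_∈ vP) (linked (a , b) xw xa) (first∈vertices P)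
    ... | z , z∈P , t =
      ∈-concatMap⁺ (proj₁ ∘ fin)
        (lose z∈P (proj₂ (fin z) w (closed (map (proj₁ ∘ proj₁) t) xw) (class xw z∈P t)))

  -- Since `X′` stays inside `X`, the cat in `X` can walk to it around the deleted edge.
  robust-step : ∀ {Q X} → Robust Q X → Infinite X → ∀ e →
    ∃[ Q′ ] ∃[ X′ ] Robust Q′ X′ × Infinite X′ × (Q′ ⇒ (Q ∖ e)) × (∀ {w} → X′ w → X w)
  robust-step {Q} {X} rob inf (a , b) with em {P = X a × X b}
  ... | no  n = Q , X , rob , inf , keep , id
    where
    open Robust rob
    keep : Q ⇒ (Q ∖ (a , b))
    keep q = q , λ { (inj₁ (refl , refl)) → n (source q , source (symQ q))
                   ; (inj₂ (refl , refl)) → n (source (symQ q) , source q) }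
  ... | yes (xa , xb) with infiniteClass rob inf xa xb
  ...   | z , xz , infz =
    _ , _ , class-robust (∖-sym symQ (a , b)) z , infz , proj₁ ,
    λ {w} cw → closed (map (proj₁ ∘ proj₁) (cw (a , b))) xz
    where
    open Robust rob
  infinite2EC⇒catWin : (G : SimpleGraph V) → HasInfinite2ECSubgraph G → CatWin G
  infinite2EC⇒catWin G (S , tec , inf) =
    catWin-invariant I step G
      (_ , _ , twoEdgeConnected⇒robust S tec , inf , Subgraph.SAdj⇒Adj S , proj₂ start)
    where
    start : ∃[ v ] Verts S v
    start = dne λ n → inf ([] , λ v sv → contradiction (v , sv) n)
    I : Rel V ℓ → V → Set (lsuc ℓ)
    I H c = ∃[ Q ] ∃[ X ] Robust Q X × Infinite X × (Q ⇒ H) × X c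
    step : ∀ (H : SimpleGraph V) {c} → I (Adj H) c → ∀ e →
           ∃[ w ] c ≢ w × Path (Adj H ∖ e) c w × I (Adj H ∖ e) w
    step H {c} (Q , X , rob , inf , Q⊆H , xc) e
      with robust-step rob inf e
    ... | Q′ , X′ , rob′ , inf′ , Q′⊆ , X′⊆ with infinite⇒another inf′ c
    ...   | w , x′w , c≢w =
      w , c≢w , toPath (map (λ (q , n) → Q⊆H q , n) (Robust.linked rob e xc (X′⊆ x′w))) ,
      Q′ , X′ , rob′ , inf′ , (λ q′ → let q , n = Q′⊆ q′ in Q⊆H q , n) , x′w

  -- A cat on a binary tree minor

  module _ {G : SimpleGraph V} (M : Minor Bω G) where
    open Minor M

    ∷ʳ-≢ : ∀ x t → x ≢ x ∷ʳ t
    ∷ʳ-≢ x t eq = SimpleGraph.irrefl Bω eq (inj₁ (t , refl))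

    exit : ∀ x t → ∃[ u ] ∃[ v ] Branch x u × Branch (x ∷ʳ t) v × SAdj S u v
    exit x t = Equivalence.to (adjacent x (x ∷ʳ t) (∷ʳ-≢ x t)) (inj₁ (t , refl))

    Below : List Letter → Pred V ℓ
    Below x v = ∃[ y ] Branch (x ++ y) v

    below-branch : ∀ {x v} → Branch x v → Below x v
    below-branch {x} {v} b = [] , subst (λ x → Branch x v) (sym (++-identityʳ x)) b

    shift : ∀ x {t y v} → Branch (x ∷ʳ t ++ y) v → Branch (x ++ t ∷ y) v
    shift x {t} {y} {v} = subst (λ x → Branch x v) (∷ʳ-++ x t y)

    below-child : ∀ {x t v} → Below (x ∷ʳ t) v → Below x v
    below-child {x} (y , b) = _ , shift x b

    branch∉below : ∀ {x t v} → Branch x v → ¬ Below (x ∷ʳ t) v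
    branch∉below {x} b (_ , b′)
      with () ← ++-cancelˡ x _ _ (disjoint (proj₂ (below-branch b)) (shift x b′))

    below-disjoint : ∀ {x s t v} → Below (x ∷ʳ s) v → Below (x ∷ʳ t) v → s ≡ t
    below-disjoint {x} (_ , b) (_ , b′)
      with refl ← ++-cancelˡ x _ _ (disjoint (shift x b) (shift x b′)) = refl

    Intact : Rel V ℓ → List Letter → Set ℓ
    Intact H x = ∀ {u v} → SAdj S u v → Below x u → Below x v → H u v

    -- The cat waits at an edge into the left subtree. A deletion with no end in that subtree spares
    -- this edge and the subtree; any other spares the branch set of `x`, the right subtree and the
    -- edges between them.
    Safe : Rel V ℓ → V → Set ℓ
    Safe H c = ∃[ x ] Branch x c × Intact H x ×
               (∃[ v ] Branch (x ∷ʳ Letter.L) v × SAdj S c v)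

    crossBranch : ∀ {H x u v} → Intact H x → Branch x u → Branch x v → Star H u v
    crossBranch {H} {x} {u} {v} int bu bv =
      map (λ (ba , bb , s) → int s (below-branch ba) (below-branch bb))
          (proj₁ (connected x u v bu bv))

    -- From the entry vertex `v` the cat crosses the intact branch set to the vertex with an edge to
    -- the left child, which restores the invariant.
    descend : ∀ {H x t c u v} → Branch x c → Star H c u → H u v →
              Branch (x ∷ʳ t) v → Intact H (x ∷ʳ t) →
              ∃[ w ] c ≢ w × Path H c w × Safe H w
    descend {H} {x} {t} {c} bc p h bv int with exit (x ∷ʳ t) Letter.L
    ... | w , v′ , bw , bv′ , s =
      w , (λ { refl → ∷ʳ-≢ x t (disjoint bc bw) }) ,
      toPath (p ◅◅ (h ◅ crossBranch {H} int bv bw)) ,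
      x ∷ʳ t , bw , int , v′ , bv′ , s

    safe-step : ∀ (H : SimpleGraph V) {c} → Safe (Adj H) c → ∀ e →
                ∃[ w ] c ≢ w × Path (Adj H ∖ e) c w × Safe (Adj H ∖ e) w
    safe-step H {c} (x , bc , int , v , bv , cv) (a , b)
      with em {P = ∃[ z ] Below (x ∷ʳ Letter.L) z × (z ≡ a ⊎ z ≡ b)}
    ... | no n =
      descend {H′} bc ε
        (int cv (below-branch bc) (below-child (below-branch bv)) , clean (below-branch bv))
        bv (λ s bu bw → int s (below-child bu) (below-child bw) , clean bw)
      where
      H′ : Rel V ℓ
      H′ = Adj H ∖ (a , b)
      clean : ∀ {u w} → Below (x ∷ʳ Letter.L) w → ¬ SameEdge (u , w) (a , b)
      clean bw (inj₁ (_ , w≡b)) = n (_ , bw , inj₂ w≡b)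
      clean bw (inj₂ (_ , w≡a)) = n (_ , bw , inj₁ w≡a)
    ... | yes (z , bz , z∈e) with exit x Letter.R
    ...   | u , w , bu , bw , s =
      descend {H′} bc
        (map (λ (p , q , r) → int r (below-branch p) (below-branch q) , clean (inj₁ p) (inj₁ q))
             (proj₁ (connected x c u bc bu)))
        (int s (below-branch bu) (below-child (below-branch bw)) ,
         clean (inj₁ bu) (inj₂ (below-branch bw)))
        bw (λ r p q → int r (below-child p) (below-child q) , clean (inj₂ p) (inj₂ q))
      where
      H′ : Rel V ℓ
      H′ = Adj H ∖ (a , b)
      Away : Pred V ℓ
      Away y = Branch x y ⊎ Below (x ∷ʳ Letter.R) y
      away≢z : ∀ {y} → Away y → z ≢ y
      away≢z (inj₁ p) refl = branch∉below p bz
      away≢z (inj₂ p) refl with () ← below-disjoint p bz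
      clean : ∀ {y y′} → Away y → Away y′ → ¬ SameEdge (y , y′) (a , b)
      clean p q (inj₁ (refl , refl)) = [ away≢z p , away≢z q ]′ z∈e
      clean p q (inj₂ (refl , refl)) = [ away≢z q , away≢z p ]′ z∈e

    minor⇒catWin : CatWin G
    minor⇒catWin with exit [] Letter.L
    ... | u , v , bu , bv , s =
      catWin-invariant Safe safe-step G
        ([] , bu , (λ s′ _ _ → Subgraph.SAdj⇒Adj S s′) , v , bv , s)

  -- Positions won by the herder

  -- Inductive, because a capture ends a finite play. If the deletion isolates the cat, the
  -- condition in `cut` is vacuous.
  data Lose (R : Rel V ℓ) (v : V) : Set ℓ where
    stuck : (∀ w → v ≢ w → ¬ Star R v w) → Lose R v
    cut   : ∀ {a b} → R a b →
            (∀ w → v ≢ w → Star (R ∖ (a , b)) v w → Lose (R ∖ (a , b)) w) → Lose R v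

  Win : Rel V ℓ → V → Set ℓ
  Win R v = ¬ Lose R v

  catWin⇒win : (G : SimpleGraph V) → CatWin G → ∃[ v ] Win (Adj G) v
  catWin⇒win G (σ , start , reply) =
    σ [] , λ l → start (λ w r → go [] [] r l)
    where
    firstEdge : ∀ {R : Rel V ℓ} {u v} → u ≢ v → Star R u v → ∃[ w ] R u w
    firstEdge u≢v ε       = contradiction refl u≢v
    firstEdge _   (r ◅ _) = _ , r

    go : ∀ es → Legal G es → ∀ {w} → Adj (remaining G es) (σ es) w →
         ¬ Lose (Adj (remaining G es)) (σ es)
    go es legal r (stuck h) = h _ (λ eq → SimpleGraph.irrefl (remaining G es) eq r) (r ◅ ε)
    go es legal r (cut {a} {b} ab f) with reply (a , b) es (ab ∷ legal)
    -- The last edge of the cat's walk shows that its new position is not isolated.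
    ... | _ , moved , (p , _)
      with firstEdge (moved ∘ sym) (rev (SimpleGraph.symm (remaining G ((a , b) ∷ es))) p)
    ...   | _ , r′ = go ((a , b) ∷ es) (ab ∷ legal) r′ (f _ moved p)

  lose-mono : ∀ {Q R : Rel V ℓ} {v} → Symmetric Q → Q ⇒ R → Lose R v → Lose Q v
  lose-mono symQ Q⊆R (stuck h) = stuck (λ w v≢w p → h w v≢w (map Q⊆R p))
  lose-mono {Q} {R} {v} symQ Q⊆R (cut {a} {b} ab f) with em {P = Q a b}
  ... | yes qab =
    cut qab λ w v≢w p →
      lose-mono (∖-sym symQ (a , b)) Q∖⊆ (f w v≢w (map Q∖⊆ p))
    where
    Q∖⊆ : (Q ∖ (a , b)) ⇒ (R ∖ (a , b))
    Q∖⊆ (q , n) = Q⊆R q , n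
  -- The prescribed edge is missing in `Q`, so the herder deletes any edge at the cat as a dummy
  -- move, or the cat is already stuck.
  ... | no ¬qab with em {P = ∃[ w ] v ≢ w × Star Q v w}
  ...   | no n = stuck (λ w v≢w p → n (w , v≢w , p))
  ...   | yes (_ , v≢v , ε) = contradiction refl v≢v
  ...   | yes (_ , _ , _◅_ {j = c} vc _) =
    cut vc λ w v≢w p →
      lose-mono (∖-sym symQ (v , c)) Q∖⊆ (f w v≢w (map Q∖⊆ p))
    where
    Q∖⊆ : (Q ∖ (v , c)) ⇒ (R ∖ (a , b))
    Q∖⊆ (q , _) = Q⊆R q , λ { (inj₁ (refl , refl)) → ¬qab q
                            ; (inj₂ (refl , refl)) → ¬qab (symQ q) }

  win-step : ∀ {R : Rel V ℓ} {v x y e} → Symmetric R → SameEdge (x , y) e → R x y →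
             Win R v → ∃[ w ] v ≢ w × Star (R ∖ e) v w × Win (R ∖ e) w
  win-step {R} {x = x} {y} {e} symR s r win =
    dne λ n → win (cut (oriented s) λ w v≢w p → dne λ l → n (w , v≢w , p , l))
    where
    oriented : ∀ {a b} → SameEdge (x , y) (a , b) → R a b
    oriented (inj₁ (refl , refl)) = r
    oriented (inj₂ (refl , refl)) = symR r

  win-edge : ∀ {R : Rel V ℓ} {v} → Win R v → ∃[ w ] R v w
  win-edge win = dne λ n → win (stuck λ { w v≢w ε → v≢w refl ; w _ (r ◅ _) → n (_ , r) })

  HasWin : Rel V ℓ → V → Set ℓ
  HasWin R p = ∃[ v ] Star R p v × Win R v

  -- Splitting winning regions by bridges

  module _ {G : SimpleGraph V} (no2EC : ¬ HasInfinite2ECSubgraph G) where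

    Split : Rel V ℓ → V → Set ℓ
    Split R p = ∃[ e ] ∃[ x ] ∃[ y ] SameEdge (x , y) e × R x y × ¬ Star (R ∖ e) x y ×
                HasWin (R ∖ e) x × HasWin (R ∖ e) y × Star (R ∖ e) p x

    -- Deleting `e` is a herder's move, to which `v` and `w` each have a winning reply on their own
    -- side. The end that `p` reaches without `e` takes the role of `x`.
    separated⇒split : ∀ {R p v w} → Symmetric R → Win R v → Win R w → Star R p v →
                      Star R v w → ∀ e → ¬ Star (R ∖ e) v w → Split R p
    separated⇒split {R} {p} {v} {w} symR wv ww pv vw e n with bridge-on symR e vw n
    ... | x , y , s , r , vx , wy = sided (reach (truncate e (pv ◅◅ map proj₁ vx)))
      where
      sym∖ : Symmetric (R ∖ e)
      sym∖ = ∖-sym symR e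
      side : ∀ {v x} → Win R v → Star (R ∖ e) v x → HasWin (R ∖ e) x
      side win vx with win-step symR s r win
      ... | w , _ , p , win′ = w , rev sym∖ vx ◅◅ p , win′
      reach : _ → Star (R ∖ e) p x ⊎ Star (R ∖ e) p y
      reach (inj₁ q) = inj₁ q
      reach (inj₂ (_ , _ , s′ , _ , q , _)) with SameEdge-trans s′ (SameEdge-sym s)
      ... | inj₁ (refl , _) = inj₁ q
      ... | inj₂ (refl , _) = inj₂ q
      ¬xy : ¬ Star (R ∖ e) x y
      ¬xy xy = n (vx ◅◅ xy ◅◅ rev sym∖ wy)
      sided : Star (R ∖ e) p x ⊎ Star (R ∖ e) p y → Split R p
      sided (inj₁ px) = e , x , y , s , r , ¬xy , side wv vx , side ww wy , px
      sided (inj₂ py) =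
        e , y , x , SameEdge-flip s , symR r , ¬xy ∘ rev sym∖ , side ww wy , side wv vx , py

    -- If no bridge splits R, all winning positions lie in one class X, which is finite.
    -- The herder then deletes the edges within X one at a time; a cat confined to X
    -- can only move along such edges.
    win⇒split : ∀ {R p} → Symmetric R → R ⇒ Adj G → HasWin R p → Split R p
    win⇒split {R} {p} symR R⊆G (v , pv , wv) = dne λ noSplit → impossible noSplit
      where
      X : Pred V ℓ
      X = Class R v

      module _ (noSplit : ¬ Split R p) where
        finX : Finite X
        finX = dne λ inf →
          no2EC (robust⇒infinite2EC (class-robust symR v) (R⊆G ∘ proj₁) inf)

        winners : ∀ {w} → Star R v w → Win R w → X w
        winners vw ww e = dne λ n → noSplit (separated⇒split symR wv ww pv vw e n)

        -- A position that wins with fewer edges also wins in `R` by `lose-mono`, so the reply lies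
        -- in `X`.
        reply : ∀ {Q a b u} → Symmetric Q → Q ⇒ R → Q a b → X u → Win Q u →
                ∃[ w ] u ≢ w × Star (Q ∖ (a , b)) u w × X w × Win (Q ∖ (a , b)) w
        reply {a = a} {b} symQ Q⊆R ab xu win with win-step symQ (inj₁ (refl , refl)) ab win
        ... | w , u≢w , p , win′ =
          w , u≢w , p ,
          winners (map proj₁ (xu (v , v)) ◅◅ map (Q⊆R ∘ proj₁) p)
            (win′ ∘ lose-mono (∖-sym symQ (a , b)) (Q⊆R ∘ proj₁)) ,
          win′

        squeeze : ∀ E {Q u} → Symmetric Q → Q ⇒ R →
                  (∀ {x y} → Q x y → X x → X y → (x , y) ∈ E) → X u → ¬ Win Q u
        squeeze [] symQ Q⊆R none xu win with win-edge win
        ... | _ , q with reply symQ Q⊆R q xu win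
        ...   | w , u≢w , p , xw , _ with toPath p
        -- Made simple, the cat's walk between members of `X` runs inside `X`, where no edge is
        -- left.
        ...     | p′ , up with classWalk symR (Q⊆R ∘ proj₁) p′ up xu xw
        ...       | ε = u≢w refl
        ...       | ((q′ , _) , x , y) ◅ _ with () ← none q′ x y
        squeeze ((a , b) ∷ E) {Q} symQ Q⊆R within xu win with em {P = Q a b}
        -- The list may contain pairs that are not edges of `Q`; these are skipped.
        ... | no n = squeeze E symQ Q⊆R within′ xu win
          where
          within′ : ∀ {x y} → Q x y → X x → X y → (x , y) ∈ E
          within′ q x y with within q x y
          ... | here refl = contradiction q n
          ... | there m   = m
        ... | yes ab with reply symQ Q⊆R ab xu win
        ...   | w , _ , _ , xw , win′ =
          squeeze E (∖-sym symQ (a , b)) (Q⊆R ∘ proj₁) within′ xw win′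
          where
          within′ : ∀ {x y} → (Q ∖ (a , b)) x y → X x → X y → (x , y) ∈ E
          within′ (q , n) x y with within q x y
          ... | here refl = contradiction (inj₁ (refl , refl)) n
          ... | there m   = m

        impossible : ⊥
        impossible =
          let xs , h = finX in
          squeeze (cartesianProduct xs xs) symR id
            (λ _ x y → ∈-cartesianProduct⁺ (h _ x) (h _ y)) (winners ε wv) wv

    -- Winning regions and forks

    record Region : Set (lsuc ℓ) where
      field
        rel  : Rel V ℓ
        symR : Symmetric rel
        ⊆G   : rel ⇒ Adj G
        base : V
        win  : HasWin rel base

      -- The region proper is a component, so deleting a bridge yields the regions on both sides
      -- from a single relation.
      Inside : Pred V ℓ
      Inside = Star rel base

    open Region

    -- The local picture of the minor: `core` becomes a branch set, and the child regions carry the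
    -- two subtrees.
    record Fork (K : Region) : Set (lsuc ℓ) where
      field
        core       : Rel V ℓ
        core-sym   : Symmetric core
        core⊆      : core ⇒ rel K
        child      : Letter → Region
        child⊆     : ∀ t → rel (child t) ⇒ rel K
        gate       : ∀ t → ∃[ u ] Star core (base K) u × rel K u (base (child t))
        core-child : ∀ t {z} → Star core (base K) z → ¬ Inside (child t) z
        children   : ∀ s t {z} → Inside (child s) z → Inside (child t) z → s ≡ t

    -- A connected region containing p and a is split by a bridge xy, with p on the side
    -- of x.  If a is on that side too, it is adjacent to two winning regions, those of y
    -- and b.  Otherwise every walk from p to a passes x, and x replaces a.
    fork : ∀ (K : Region) n {A a b} → Symmetric A → A ⇒ rel K → rel K a b →
           (w : Star A (base K) a) → steps w < n →
           HasWin A (base K) → HasWin A b → ¬ Star A a b → Fork K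
    fork K (suc n) {A} {a} {b} symA A⊆ ab w lt hp hb nab
      with win⇒split symA (⊆G K ∘ A⊆) hp
    ... | e , x , y , s , axy , nxy , hx , hy , px = cases (truncate e w)
      where
      p = base K
      sym∖ : Symmetric (A ∖ e)
      sym∖ = ∖-sym symA e

      cases : _ → Fork K
      cases (inj₂ (_ , _ , s′ , _ , q , lt′)) with SameEdge-trans s′ (SameEdge-sym s)
      ... | inj₁ (refl , refl) =
        fork K n sym∖ (A⊆ ∘ proj₁) (A⊆ axy) q (≤-trans lt′ (s≤s⁻¹ lt))
          (let v , xv , wv = hx in v , px ◅◅ xv , wv) hy nxy
      ... | inj₂ (refl , refl) = contradiction (rev sym∖ px ◅◅ q) nxy
      cases (inj₁ q) = record
        { core = A ∖ e ; core-sym = sym∖ ; core⊆ = A⊆ ∘ proj₁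
        ; child = child ; child⊆ = child⊆ ; gate = gate
        ; core-child = core-child ; children = children }
        where
        child : Letter → Region
        child Letter.L = record
          { rel = A ∖ e ; symR = sym∖ ; ⊆G = ⊆G K ∘ A⊆ ∘ proj₁ ; base = y ; win = hy }
        -- The component of `b` in `A` is disjoint from that of `p`, which contains `e`, so `A`
        -- itself serves here.
        child Letter.R = record
          { rel = A ; symR = symA ; ⊆G = ⊆G K ∘ A⊆ ; base = b ; win = hb }

        child⊆ : ∀ t → rel (child t) ⇒ rel K
        child⊆ Letter.L = A⊆ ∘ proj₁
        child⊆ Letter.R = A⊆

        gate : ∀ t → ∃[ u ] Star (A ∖ e) p u × rel K u (base (child t))
        gate Letter.L = x , px , A⊆ axy
        gate Letter.R = a , q , ab

        core-child : ∀ t {z} → Star (A ∖ e) p z → ¬ Inside (child t) z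
        core-child Letter.L pz yz = nxy (rev sym∖ px ◅◅ pz ◅◅ rev sym∖ yz)
        core-child Letter.R pz bz = nab (rev symA w ◅◅ map proj₁ pz ◅◅ rev symA bz)

        L-R : ∀ {z} → Star (A ∖ e) y z → ¬ Star A b z
        L-R yz bz =
          nab (rev symA w ◅◅ map proj₁ px ◅◅ (axy ◅ map proj₁ yz) ◅◅ rev symA bz)

        children : ∀ s t {z} → Inside (child s) z → Inside (child t) z → s ≡ t
        children Letter.L Letter.L _ _ = refl
        children Letter.L Letter.R i j = contradiction j (L-R i)
        children Letter.R Letter.L i j = contradiction i (L-R j)
        children Letter.R Letter.R _ _ = refl

    abstract
      forkOf : ∀ K → Fork K
      forkOf K with win⇒split (symR K) (⊆G K) (win K)
      ... | e , x , y , s , xy , nxy , hx , hy , px =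
        fork K (suc (steps px)) (∖-sym (symR K) e) proj₁ xy px ≤-refl
          (let v , xv , wv = hx in v , px ◅◅ xv , wv) hy nxy

    -- The branch sets of the tree minor

    node : Region → List Letter → Region
    node K []      = K
    node K (t ∷ α) = node (Fork.child (forkOf K) t) α

    Piece : Region → List Letter → Pred V ℓ
    Piece K α = let N = node K α in Star (Fork.core (forkOf N)) (base N)

    child-inside : ∀ K t {v} → Inside (Fork.child (forkOf K) t) v → Inside K v
    child-inside K t i =
      let _ , h , r = gate t in map core⊆ h ◅◅ (r ◅ map (child⊆ t) i)
      where open Fork (forkOf K)

    piece-inside : ∀ K α {v} → Piece K α v → Inside K v
    piece-inside K []      i = map (Fork.core⊆ (forkOf K)) i
    piece-inside K (t ∷ α) i = child-inside K t (piece-inside _ α i)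

    piece-disjoint : ∀ K α β {v} → Piece K α v → Piece K β v → α ≡ β
    piece-disjoint K []      []      _ _ = refl
    piece-disjoint K []      (t ∷ β) i j =
      contradiction (piece-inside _ β j) (Fork.core-child (forkOf K) t i)
    piece-disjoint K (t ∷ α) []      i j =
      contradiction (piece-inside _ α i) (Fork.core-child (forkOf K) t j)
    piece-disjoint K (s ∷ α) (t ∷ β) i j
      with refl ← Fork.children (forkOf K) s t (piece-inside _ α i) (piece-inside _ β j)
      = cong (s ∷_) (piece-disjoint _ α β i j)

    piece-gate : ∀ K α t → ∃[ u ] ∃[ v ] Piece K α u × Piece K (α ∷ʳ t) v × Adj G u v
    piece-gate K [] t = let u , h , r = Fork.gate (forkOf K) t in u , _ , h , ε , ⊆G K r
    piece-gate K (s ∷ α) t = piece-gate _ α t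

    region⇒minor : Region → Minor Bω G
    region⇒minor K = record
      { S         = S
      ; Branch    = Piece K
      ; covers    = λ v → mk⇔ id id
      ; disjoint  = piece-disjoint K _ _
      ; nonempty  = λ x → _ , ε
      ; connected = conn
      ; adjacent  = λ x y x≢y → mk⇔ (to x y) (from x y x≢y)
      }
      where
      S : Subgraph G
      S = record
        -- Edges of `G` between branch sets of words not adjacent in `Bω` are left out, as they
        -- would create further adjacencies.
        { Verts = λ v → ∃[ x ] Piece K x v
        ; SAdj = λ u v → Adj G u v × (∃[ x ] ∃[ y ] Piece K x u × Piece K y v ×
                                        (x ≡ y ⊎ Adj Bω x y))
        ; SAdj⇒Adj = proj₁
        ; SAdj-src = λ (_ , x , _ , i , _) → x , i
        ; SAdj-sym = λ (r , x , y , i , j , a) →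
            SimpleGraph.symm G r , y , x , j , i , map⊎ sym (SimpleGraph.symm Bω) a
        }

      conn : ∀ x u v → Piece K x u → Piece K x v →
             Path (λ a b → Piece K x a × Piece K x b × SAdj S a b) u v
      conn x u v i j =
        toPath (map (λ (r , k , l) → k , l , ⊆G N (core⊆ r) , x , x , k , l , inj₁ refl)
                    (tracked i (rev core-sym i ◅◅ j)))
        where
        N = node K x
        open Fork (forkOf N)

      to : ∀ x y → Adj Bω x y → ∃[ u ] ∃[ v ] Piece K x u × Piece K y v × SAdj S u v
      to x _ a@(inj₁ (t , refl)) =
        let u , v , i , j , r = piece-gate K x t in
        u , v , i , j , r , _ , _ , i , j , inj₂ a
      to _ y a@(inj₂ (t , refl)) =
        let v , u , j , i , r = piece-gate K y t in
        u , v , i , j , SimpleGraph.symm G r , _ , _ , i , j , inj₂ a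

      from : ∀ x y → x ≢ y →
             (∃[ u ] ∃[ v ] Piece K x u × Piece K y v × SAdj S u v) → Adj Bω x y
      from x y x≢y (_ , _ , i , j , _ , x′ , y′ , i′ , j′ , a)
        with refl ← piece-disjoint K x x′ i i′ | refl ← piece-disjoint K y y′ j j′
        = [ (λ eq → contradiction eq x≢y) , id ]′ a

mainTheorem15 : (∀ {a : Level} → ExcludedMiddle a) →
    ∀ {ℓ : Level} {V : Set ℓ} (G : SimpleGraph V) →
    CatWin G ⇔ (Minor Bω G ⊎ HasInfinite2ECSubgraph G)
mainTheorem15 em {V = V} G = mk⇔ to [ minor⇒catWin , infinite2EC⇒catWin G ]′
  where
  open Classical em {V = V}
  to : CatWin G → Minor Bω G ⊎ HasInfinite2ECSubgraph G
  to win with em {P = HasInfinite2ECSubgraph G}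
  ... | yes h = inj₂ h
  ... | no  n =
    let v , w = catWin⇒win G win in
    -- The root region is the component of a winning position in `G`.
    inj₁ (region⇒minor n record
      { rel = Adj G ; symR = SimpleGraph.symm G ; ⊆G = id ; base = v ; win = v , ε , w })
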